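{- For every positive integer $t$, the class of graphs with no vertex-minor isomorphic to the path $P_t$ on $t$ vertices is linearly $\chi$-bounded; that is, there is a linear function $f$ such that $\chi(H)\le f(\omega(H))$ for every graph $H$ with no vertex-minor isomorphic to $P_t$.
   Context: Graphs are finite and simple. $\chi(G)$ is the chromatic number and $\omega(G)$ the clique number of $G$. A class $\mathcal C$ is $\chi$-bounded if there is a function $f$ with $\chi(H)\le f(\omega(H))$ for all induced subgraphs $H$ of graphs in $\mathcal C$, and linearly $\chi$-bounded if $f$ can be taken linear (note the class in question is closed under induced subgraphs). Local complementation at $v$ gives $G*v$ with edge set $E(G)\,\Delta\,\{xy:x,y\in N_G(v),x\ne y\}$; $H$ is a vertex-minor of $G$ if $H$ is an induced subgraph of a graph obtained from $G$ by a sequence of local complementations. -}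

module Defs where

open import Data.Nat using (ℕ; suc; _+_; _*_; _≡ᵇ_)
open import Data.Fin using (Fin; toℕ; _≟_)
open import Data.Bool using (Bool; true; false; not; _∧_; _∨_; if_then_else_)
open import Data.List using (List; foldl)
open import Data.Product using (Σ; ∃; _×_; _,_)
open import Relation.Nullary using (¬_; does)
open import Relation.Binary.PropositionalEquality using (_≡_; _≢_)
open import Function.Definitions using (Injective)

record Graph (n : ℕ) : Set where
  field
    adj    : Fin n → Fin n → Bool
    sym    : ∀ x y → adj x y ≡ adj y x
    irrefl : ∀ x → adj x x ≡ false
open Graph public

lcSeqAdj : ∀ {n} → Graph n → List (Fin n) → Fin n → Fin n → Bool
lcSeqAdj {n} G vs = foldl step (adj G) vs
  where
  step : (Fin n → Fin n → Bool) → Fin n → Fin n → Fin n → Bool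
  step a v x y =
    if not (does (x ≟ y)) ∧ a v x ∧ a v y then not (a x y) else a x y

pathAdj : ∀ {t} → Fin t → Fin t → Bool
pathAdj i j = (suc (toℕ i) ≡ᵇ toℕ j) ∨ (suc (toℕ j) ≡ᵇ toℕ i)

HasPathVertexMinor : ∀ {n} → ℕ → Graph n → Set
HasPathVertexMinor {n} t G =
  Σ (List (Fin n)) λ vs → Σ (Fin t → Fin n) λ φ →
    Injective _≡_ _≡_ φ × (∀ i j → lcSeqAdj G vs (φ i) (φ j) ≡ pathAdj i j)

HasClique : ∀ {n} → Graph n → ℕ → Set
HasClique {n} G w =
  Σ (Fin w → Fin n) λ φ → Injective _≡_ _≡_ φ ×
    (∀ i j → i ≢ j → adj G (φ i) (φ j) ≡ true)

CliqueNumber : ∀ {n} → Graph n → ℕ → Set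
CliqueNumber G w = HasClique G w × ¬ HasClique G (suc w)

Colourable : ∀ {n} → Graph n → ℕ → Set
Colourable {n} G k =
  Σ (Fin n → Fin k) λ c → ∀ x y → adj G x y ≡ true → c x ≢ c y

{-# OPTIONS --safe #-}
-- Call X ⊆ V(G) g-good if g colours per vertex of a clique of X suffice to colour X, and likewise in
-- the complement of G.  Goodness is subadditive, is preserved by complete and by anticomplete unions,
-- and is invariant under complementation.  Suppose an induced path p₁ … pₖ of a local-complementation
-- equivalent graph has pₖ complete and p₁ … pₖ₋₁ anticomplete to X.  For x ∈ X, local complementation
-- at x separates pₖ from N(x) ∩ X and complements N(x) ∩ X, so that p₁ … pₖ x and N(x) ∩ X are again
-- in this situation.  By induction on t − k all neighbourhoods inside X are s-good for some s depending
-- on t and k only, and Gyárfás' path argument, run inside X, bounds the goodness of X linearly in s.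
module Submission where

open import Defs
open import Data.Nat using (ℕ; zero; suc; _+_; _*_; _≤_; _<_; _≡ᵇ_; z≤n; s≤s)
open import Data.Nat.Properties
  using (≤-trans; ≤-refl; ≤-total; ≤-<-connex; <-≤-trans; <⇒≱; m≤m+n; +-monoʳ-<; +-mono-≤; *-monoʳ-≤;
         *-distribˡ-+; *-distribʳ-+; +-cancelˡ-≡; +-suc; +-identityʳ; m≤n⇒m⊓n≡m; ≤-reflexive)
open import Data.Fin using (Fin; zero; suc; _≟_; toℕ; fromℕ<)
open import Data.Fin.Properties using (any?; fromℕ<-injective)
open import Data.Fin.Subset
  using (Subset; _∈_; _∉_; _⊆_; _⊂_; _∩_; _─_; ⁅_⁆; ⊤; Nonempty; inside; outside)
open import Data.Fin.Subset.Properties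
  using (_∈?_; _⊆?_; nonempty?; anySubset?; p∩q⊆p; p∩q⊆q; x∈p∩q⁺; x∈p∧x∉q⇒x∈p─q; p─q⊆p; p∩q≢∅⇒p─q⊂p;
         x∈⁅x⁆; x∈⁅y⁆⇒x≡y; x≢y⇒x∉⁅y⁆; ∈⊤)
open import Data.Fin.Subset.Induction using (⊂-wellFounded; Acc; acc)
open import Data.Bool using (true; false; not; _∧_; if_then_else_)
import Data.Bool.Properties as Bool
open import Data.List using (List; []; _∷_; length; _++_; take; lookup)
open import Data.List.Properties using (length-++; length-take)
open import Data.List.Relation.Unary.All as ListAll using ([]; _∷_)
import Data.List.Relation.Unary.All.Properties as ListAll
open import Data.List.Relation.Unary.AllPairs as AllPairs using (AllPairs; []; _∷_)
import Data.List.Relation.Unary.AllPairs.Properties as AllPairs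
open import Data.List.Membership.Propositional.Properties using (∈-lookup)
open import Data.Vec as Vec using (Vec; []; _∷_; tabulate; there)
open import Data.Vec.Properties using (lookup∘tabulate; lookup⇒[]=; []=⇒lookup)
open import Data.Vec.Relation.Unary.All as All using (All; []; _∷_)
import Data.Vec.Relation.Unary.All.Properties as All
open import Data.Product using (Σ; ∃; ∃₂; ∃-syntax; _×_; _,_; proj₁; proj₂)
open import Data.Sum using (inj₁; inj₂)
open import Data.Unit using (tt) renaming (⊤ to Unit)
open import Data.Empty using (⊥-elim)
open import Level using (0ℓ)
open import Function using (_∘_; id)
open import Relation.Binary using (Rel)
open import Relation.Nullary using (¬_; Dec; yes; no; does; contradiction)
open import Relation.Nullary.Decidable using (_×-dec_; ¬?; dec-true; dec-false)
open import Relation.Binary.PropositionalEquality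
  using (_≡_; _≢_; refl; trans; cong; subst; ≢-sym) renaming (sym to ≡-sym)

private
  variable
    n k g h t : ℕ
    X A : Subset n

-- Auxiliary facts about subsets and lists.

x∈p─q⇒x∉q : ∀ {x : Fin n} {p q} → x ∈ p ─ q → x ∉ q
x∈p─q⇒x∉q {p = _ ∷ _} {outside ∷ _} (there x∈p─q) (there x∈q) = x∈p─q⇒x∉q x∈p─q x∈q
x∈p─q⇒x∉q {p = _ ∷ _} {inside  ∷ _} (there x∈p─q) (there x∈q) = x∈p─q⇒x∉q x∈p─q x∈q

length-take-≤ : ∀ {A : Set} m (xs : List A) → m ≤ length xs → length (take m xs) ≡ m
length-take-≤ m xs m≤ = trans (length-take m xs) (m≤n⇒m⊓n≡m m≤)

AllPairs-lookup : ∀ {A : Set} {R : Rel A 0ℓ} → (∀ {x y} → R x y → R y x) →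
                  ∀ {xs} → AllPairs R xs → ∀ {i j} → i ≢ j → R (lookup xs i) (lookup xs j)
AllPairs-lookup R-sym (_ ∷ _)   {zero}  {zero}  i≢j = contradiction refl i≢j
AllPairs-lookup R-sym (Rx ∷ _)  {zero}  {suc j} i≢j = ListAll.lookup Rx (∈-lookup j)
AllPairs-lookup R-sym (Rx ∷ _)  {suc i} {zero}  i≢j = R-sym (ListAll.lookup Rx (∈-lookup i))
AllPairs-lookup R-sym (_ ∷ Rxs) {suc i} {suc j} i≢j = AllPairs-lookup R-sym Rxs (i≢j ∘ cong suc)

-- Balanced sets of a relation

-- Any clique inside `X`, maximum or not, serves as a certificate; measuring colours against its
-- length keeps clique numbers out of the proof until the end.
record Balanced (R : Rel (Fin n) 0ℓ) (g : ℕ) (X : Subset n) : Set where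
  field
    clique   : List (Fin n)
    clique⊆X : ListAll.All (_∈ X) clique
    pairwise : AllPairs R clique
    colour   : Fin n → ℕ
    bounded  : ∀ {x} → x ∈ X → colour x < g * length clique
    proper   : ∀ {x y} → x ∈ X → y ∈ X → R x y → colour x ≢ colour y

module _ {R : Rel (Fin n) 0ℓ} where
  open Balanced

  balanced-empty : ¬ Nonempty X → Balanced R g X
  balanced-empty empty = record
    { clique   = []
    ; clique⊆X = []
    ; pairwise = []
    ; colour   = λ _ → 0
    ; bounded  = λ x∈X → contradiction (_ , x∈X) empty
    ; proper   = λ x∈X → contradiction (_ , x∈X) empty
    }

  balanced-singleton : ∀ {x} → ¬ R x x → Balanced R 1 ⁅ x ⁆
  balanced-singleton {x} ¬Rxx = record
    { clique   = x ∷ []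
    ; clique⊆X = x∈⁅x⁆ x ∷ []
    ; pairwise = [] ∷ []
    ; colour   = λ _ → 0
    ; bounded  = λ _ → s≤s z≤n
    ; proper   = proper′
    }
    where
    proper′ : ∀ {y z} → y ∈ ⁅ x ⁆ → z ∈ ⁅ x ⁆ → R y z → 0 ≢ 0
    proper′ y∈ z∈ Ryz _ with refl ← x∈⁅y⁆⇒x≡y x y∈ | refl ← x∈⁅y⁆⇒x≡y x z∈ = ¬Rxx Ryz

  module _ (A⊆X : A ⊆ X) (P : Balanced R g A) (Q : Balanced R h (X ─ A)) where

    X─A⊆X : X ─ A ⊆ X
    X─A⊆X = p─q⊆p X A

    longer : ∃[ ws ] ListAll.All (_∈ X) ws × AllPairs R ws ×
             length (clique P) ≤ length ws × length (clique Q) ≤ length ws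
    longer with ≤-total (length (clique P)) (length (clique Q))
    ... | inj₁ p≤q = clique Q , ListAll.map X─A⊆X (clique⊆X Q) , pairwise Q , p≤q , ≤-refl
    ... | inj₂ q≤p = clique P , ListAll.map A⊆X (clique⊆X P) , pairwise P , ≤-refl , q≤p

    -- `f` relocates the palette of `Q`: the identity lets both parts share colours, a shift by the
    -- palette size of `P` makes them disjoint.
    glue : (ℕ → ℕ) → Fin n → ℕ
    glue f x with x ∈? A
    ... | yes _ = colour P x
    ... | no  _ = f (colour Q x)

    glue-bounded : ∀ {f m} → (∀ {x} → x ∈ A → colour P x < m) →
                   (∀ {x} → x ∈ X ─ A → f (colour Q x) < m) →
                   ∀ {x} → x ∈ X → glue f x < m
    glue-bounded bP bQ {x} x∈X with x ∈? A
    ... | yes x∈A = bP x∈A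
    ... | no  x∉A = bQ (x∈p∧x∉q⇒x∈p─q x∈X x∉A)

    glue-proper : ∀ {f} → (∀ {i j} → f i ≡ f j → i ≡ j) →
                  (∀ {x y} → x ∈ A → y ∈ X ─ A → R x y → colour P x ≢ f (colour Q y)) →
                  (∀ {x y} → x ∈ A → y ∈ X ─ A → R y x → colour P x ≢ f (colour Q y)) →
                  ∀ {x y} → x ∈ X → y ∈ X → R x y → glue f x ≢ glue f y
    glue-proper f-inj sep sep′ {x} {y} x∈X y∈X Rxy with x ∈? A | y ∈? A
    ... | yes x∈A | yes y∈A = proper P x∈A y∈A Rxy
    ... | yes x∈A | no  y∉A = sep x∈A (x∈p∧x∉q⇒x∈p─q y∈X y∉A) Rxy
    ... | no  x∉A | yes y∈A = ≢-sym (sep′ y∈A (x∈p∧x∉q⇒x∈p─q x∈X x∉A) Rxy)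
    ... | no  x∉A | no  y∉A =
      proper Q (x∈p∧x∉q⇒x∈p─q x∈X x∉A) (x∈p∧x∉q⇒x∈p─q y∈X y∉A) Rxy ∘ f-inj

    offset-disjoint : ∀ {x i} → x ∈ A → colour P x ≢ g * length (clique P) + i
    offset-disjoint x∈A eq = <⇒≱ (bounded P x∈A) (≤-trans (m≤m+n _ _) (≤-reflexive (≡-sym eq)))

    -- Disjoint palettes cope with any pairs across the parts; the longer of the two cliques pays
    -- for each palette, so the factors add.
    balanced-+ : Balanced R (g + h) X
    balanced-+ with ws , ws⊆X , Rws , p≤ , q≤ ← longer = record
      { clique   = ws
      ; clique⊆X = ws⊆X
      ; pairwise = Rws
      ; colour   = glue (g * length (clique P) +_)
      ; bounded  = glue-bounded
          (λ x∈A → <-≤-trans (bounded P x∈A) (≤-trans (m≤m+n _ _) total))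
          (λ x∈X─A → <-≤-trans (+-monoʳ-< _ (bounded Q x∈X─A)) total)
      ; proper   = glue-proper (+-cancelˡ-≡ _ _ _)
          (λ x∈A _ _ → offset-disjoint x∈A) (λ x∈A _ _ → offset-disjoint x∈A)
      }
      where
      total : g * length (clique P) + h * length (clique Q) ≤ (g + h) * length ws
      total = ≤-trans (+-mono-≤ (*-monoʳ-≤ g p≤) (*-monoʳ-≤ h q≤))
                      (≤-reflexive (≡-sym (*-distribʳ-+ (length ws) g h)))

  -- Both parts reuse one palette, and the longer clique pays for it.
  balanced-anticomplete : A ⊆ X → (∀ {x y} → x ∈ A → y ∈ X ─ A → ¬ R x y × ¬ R y x) →
                          Balanced R g A → Balanced R g (X ─ A) → Balanced R g X
  balanced-anticomplete {g = g} A⊆X anti P Q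
    with ws , ws⊆X , Rws , p≤ , q≤ ← longer A⊆X P Q = record
      { clique   = ws
      ; clique⊆X = ws⊆X
      ; pairwise = Rws
      ; colour   = glue A⊆X P Q id
      ; bounded  = glue-bounded A⊆X P Q
          (λ x∈A → <-≤-trans (bounded P x∈A) (*-monoʳ-≤ g p≤))
          (λ x∈X─A → <-≤-trans (bounded Q x∈X─A) (*-monoʳ-≤ g q≤))
      ; proper   = glue-proper A⊆X P Q id
          (λ x∈A y∈ Rxy → contradiction Rxy (proj₁ (anti x∈A y∈)))
          (λ x∈A y∈ Ryx → contradiction Ryx (proj₂ (anti x∈A y∈)))
      }

  -- The two cliques concatenate, so their lengths add just as the sizes of two disjoint palettes
  -- do.
  balanced-complete : A ⊆ X → (∀ {x y} → x ∈ A → y ∈ X ─ A → R x y) →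
                      Balanced R g A → Balanced R g (X ─ A) → Balanced R g X
  balanced-complete {A = A} {X = X} {g = g} A⊆X comp P Q = record
    { clique   = clique P ++ clique Q
    ; clique⊆X = ListAll.++⁺ (ListAll.map A⊆X (clique⊆X P)) (ListAll.map (p─q⊆p X A) (clique⊆X Q))
    ; pairwise = AllPairs.++⁺ (pairwise P) (pairwise Q)
        (ListAll.map (λ x∈A → ListAll.map (comp x∈A) (clique⊆X Q)) (clique⊆X P))
    ; colour   = glue A⊆X P Q (g * p +_)
    ; bounded  = λ x∈X → <-≤-trans (sum-bounded x∈X) (≤-reflexive total)
    ; proper   = glue-proper A⊆X P Q (+-cancelˡ-≡ _ _ _)
          (λ x∈A _ _ → offset-disjoint A⊆X P Q x∈A) (λ x∈A _ _ → offset-disjoint A⊆X P Q x∈A)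
    }
    where
    p q : ℕ
    p = length (clique P)
    q = length (clique Q)
    sum-bounded : ∀ {x} → x ∈ X → glue A⊆X P Q (g * p +_) x < g * p + g * q
    sum-bounded = glue-bounded A⊆X P Q
      (λ x∈A → <-≤-trans (bounded P x∈A) (m≤m+n _ _)) (λ x∈X─A → +-monoʳ-< _ (bounded Q x∈X─A))
    total : g * p + g * q ≡ g * length (clique P ++ clique Q)
    total = trans (≡-sym (*-distribˡ-+ g p q)) (cong (g *_) (≡-sym (length-++ (clique P))))

balanced-map : ∀ {R R′ : Rel (Fin n) 0ℓ} →
               (∀ {x y} → x ∈ X → y ∈ X → R x y → R′ x y) →
               (∀ {x y} → x ∈ X → y ∈ X → R′ x y → R x y) →
               Balanced R g X → Balanced R′ g X
balanced-map {X = X} {R = R} {R′ = R′} to from P = record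
  { clique   = clique
  ; clique⊆X = clique⊆X
  ; pairwise = pairwise-map clique⊆X pairwise
  ; colour   = colour
  ; bounded  = bounded
  ; proper   = λ x∈X y∈X → proper x∈X y∈X ∘ from x∈X y∈X
  }
  where
  open Balanced P
  pairwise-map : ∀ {xs} → ListAll.All (_∈ X) xs → AllPairs R xs → AllPairs R′ xs
  pairwise-map []            []         = []
  pairwise-map (x∈X ∷ xs⊆X) (Rx ∷ Rxs) =
    ListAll.zipWith (λ (y∈X , Rxy) → to x∈X y∈X Rxy) (xs⊆X , Rx) ∷ pairwise-map xs⊆X Rxs

-- Good sets of a graph

Edge NonEdge : Graph n → Rel (Fin n) 0ℓ
Edge    G x y = x ≢ y × adj G x y ≡ true
NonEdge G x y = x ≢ y × adj G x y ≡ false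

Edge-sym : ∀ (G : Graph n) {x y} → Edge G x y → Edge G y x
Edge-sym G (x≢y , xy) = ≢-sym x≢y , trans (sym G _ _) xy

adj⇒Edge : ∀ (G : Graph n) {x y} → adj G x y ≡ true → Edge G x y
adj⇒Edge G {x} xy = (λ { refl → contradiction (trans (≡-sym xy) (irrefl G x)) λ () }) , xy

Good : Graph n → ℕ → Subset n → Set
Good G g X = Balanced (Edge G) g X × Balanced (NonEdge G) g X

good-empty : ∀ (G : Graph n) → ¬ Nonempty X → Good G g X
good-empty G empty = balanced-empty empty , balanced-empty empty

good-singleton : ∀ (G : Graph n) {x} → Good G 1 ⁅ x ⁆
good-singleton G = balanced-singleton (λ (x≢x , _) → x≢x refl) , balanced-singleton (λ (x≢x , _) → x≢x refl)

good-+ : ∀ (G : Graph n) → A ⊆ X → Good G g A → Good G h (X ─ A) → Good G (g + h) X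
good-+ G A⊆X (P , P′) (Q , Q′) = balanced-+ A⊆X P Q , balanced-+ A⊆X P′ Q′

-- Crossing edges, separations and connected components.

Crossing : Graph n → Subset n → Subset n → Set
Crossing G A B = ∃₂ λ x y → x ∈ A × y ∈ B × adj G x y ≡ true

crossing? : ∀ (G : Graph n) A B → Dec (Crossing G A B)
crossing? G A B = any? λ x → any? λ y → (x ∈? A) ×-dec (y ∈? B) ×-dec (adj G x y Bool.≟ true)

-- In the complement the same partition is complete. That `g` is kept rather than doubled is what
-- allows components to be treated separately.
good-anticomplete : ∀ (G : Graph n) → A ⊆ X → ¬ Crossing G A (X ─ A) →
                    Good G g A → Good G g (X ─ A) → Good G g X
good-anticomplete {A = A} {X = X} G A⊆X ¬cross (P , P′) (Q , Q′) =
  balanced-anticomplete A⊆X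
    (λ x∈A y∈ → (λ (_ , xy) → ¬cross (_ , _ , x∈A , y∈ , xy)) ,
                (λ (_ , yx) → ¬cross (_ , _ , x∈A , y∈ , trans (sym G _ _) yx))) P Q ,
  balanced-complete A⊆X
    (λ x∈A y∈ → (λ { refl → x∈p─q⇒x∉q y∈ x∈A }) ,
                Bool.¬-not (λ xy → ¬cross (_ , _ , x∈A , y∈ , xy))) P′ Q′

Separation : Graph n → Subset n → Subset n → Set
Separation G X A = A ⊆ X × Nonempty A × Nonempty (X ─ A) × ¬ Crossing G A (X ─ A)

separation? : ∀ (G : Graph n) X → Dec (∃ (Separation G X))
separation? G X = anySubset? λ A →
  (A ⊆? X) ×-dec nonempty? A ×-dec nonempty? (X ─ A) ×-dec ¬? (crossing? G A (X ─ A))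

Connected : Graph n → Subset n → Set
Connected G X = ∀ A → A ⊆ X → Nonempty A → Nonempty (X ─ A) → Crossing G A (X ─ A)

¬separation⇒connected : ∀ (G : Graph n) X → ¬ ∃ (Separation G X) → Connected G X
¬separation⇒connected G X ¬sep A A⊆X A≠∅ X─A≠∅ with crossing? G A (X ─ A)
... | yes cross  = cross
... | no  ¬cross = contradiction (A , (λ {_} → A⊆X) , A≠∅ , X─A≠∅ , ¬cross) ¬sep

record Component (G : Graph n) (X K : Subset n) : Set where
  field
    K⊆X       : K ⊆ X
    nonempty  : Nonempty K
    connected : Connected G K
    isolated  : ¬ Crossing G K (X ─ K)

component-refl : ∀ {G : Graph n} → Nonempty X → Connected G X → Component G X X
component-refl {X = X} X≠∅ conn = record
  { K⊆X       = id
  ; nonempty  = X≠∅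
  ; connected = conn
  ; isolated  = λ (_ , _ , _ , y∈X─X , _) → x∈p─q⇒x∉q y∈X─X (p─q⊆p X X y∈X─X)
  }

component-mono : ∀ {G : Graph n} {K} → A ⊆ X → ¬ Crossing G A (X ─ A) → Component G A K → Component G X K
component-mono {A = A} {X = X} {G = G} {K} A⊆X ¬cross comp = record
  { K⊆X       = A⊆X ∘ K⊆X
  ; nonempty  = nonempty
  ; connected = connected
  ; isolated  = isolated′
  }
  where
  open Component comp
  isolated′ : ¬ Crossing G K (X ─ K)
  isolated′ (x , y , x∈K , y∈X─K , xy) with y ∈? A
  ... | yes y∈A = isolated (x , y , x∈K , x∈p∧x∉q⇒x∈p─q y∈A (x∈p─q⇒x∉q y∈X─K) , xy)
  ... | no  y∉A = ¬cross (x , y , K⊆X x∈K , x∈p∧x∉q⇒x∈p─q (p─q⊆p X K y∈X─K) y∉A , xy)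

co-isolated : ∀ {G : Graph n} → A ⊆ X → ¬ Crossing G A (X ─ A) → ¬ Crossing G (X ─ A) (X ─ (X ─ A))
co-isolated {A = A} {X = X} {G} A⊆X ¬cross (x , y , x∈ , y∈ , xy) with y ∈? A
... | yes y∈A = ¬cross (y , x , y∈A , x∈ , trans (sym G _ _) xy)
... | no  y∉A = x∈p─q⇒x∉q y∈ (x∈p∧x∉q⇒x∈p─q (p─q⊆p X (X ─ A) y∈) y∉A)

-- `X` is split along separations, by recursion on strict inclusion, until the parts are connected;
-- components of a part are components of `X`, and no split increases `g`.
good-components : ∀ (G : Graph n) X → (∀ K → Component G X K → Good G g K) → Good G g X
good-components {n} {g} G X = go X (⊂-wellFounded X)
  where
  go : ∀ X → Acc _⊂_ X → (∀ K → Component G X K → Good G g K) → Good G g X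
  go X (acc rec) good with nonempty? X | separation? G X
  ... | no  X=∅ | _      = good-empty G X=∅
  ... | yes X≠∅ | no ¬sep = good X (component-refl X≠∅ (¬separation⇒connected G X ¬sep))
  ... | yes _   | yes (A , A⊆X , (a , a∈A) , (b , b∈X─A) , ¬cross) =
    good-anticomplete G A⊆X ¬cross
      (go A (rec A⊂X) (λ K → good K ∘ component-mono A⊆X ¬cross))
      (go (X ─ A) (rec X─A⊂X) (λ K → good K ∘ component-mono (p─q⊆p X A) (co-isolated {G = G} A⊆X ¬cross)))
    where
    A⊂X : A ⊂ X
    A⊂X = A⊆X , b , p─q⊆p X A b∈X─A , x∈p─q⇒x∉q b∈X─A
    X─A⊂X : X ─ A ⊂ X
    X─A⊂X = p∩q≢∅⇒p─q⊂p X A (a , x∈p∩q⁺ (A⊆X a∈A , a∈A))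

-- Induced paths, listed from the last vertex pₖ down to p₁

-- The empty path imposes no condition, so the induction can start from the whole vertex set.
Linked : Graph n → Fin n → Vec (Fin n) k → Set
Linked G x []       = Unit
Linked G x (p ∷ ps) = Edge G x p × All (NonEdge G x) ps

InducedPath : Graph n → Vec (Fin n) k → Set
InducedPath G []       = Unit
InducedPath G (x ∷ ps) = Linked G x ps × InducedPath G ps

linked⇒≢ : ∀ (G : Graph n) {x} (ps : Vec (Fin n) k) → Linked G x ps → ∀ i → x ≢ Vec.lookup ps i
linked⇒≢ G (_ ∷ _)  ((x≢p , _) , _) zero    = x≢p
linked⇒≢ G (_ ∷ ps) (_ , apart)     (suc i) = proj₁ (All.lookup⁺ apart i)

inducedPath-injective : ∀ (G : Graph n) (ps : Vec (Fin n) k) → InducedPath G ps →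
                        ∀ {i j} → Vec.lookup ps i ≡ Vec.lookup ps j → i ≡ j
inducedPath-injective G (_ ∷ _)  _             {zero}  {zero}  _  = refl
inducedPath-injective G (_ ∷ ps) (linked , _)  {zero}  {suc j} eq = contradiction eq (linked⇒≢ G ps linked j)
inducedPath-injective G (_ ∷ ps) (linked , _)  {suc i} {zero}  eq = contradiction (≡-sym eq) (linked⇒≢ G ps linked i)
inducedPath-injective G (_ ∷ ps) (_ , induced) {suc i} {suc j} eq = cong suc (inducedPath-injective G ps induced eq)

linked-adj : ∀ (G : Graph n) {x} (ps : Vec (Fin n) k) → Linked G x ps →
             ∀ j → adj G x (Vec.lookup ps j) ≡ pathAdj zero (suc j)
linked-adj G (_ ∷ _)  ((_ , xp) , _) zero    = xp
linked-adj G (_ ∷ ps) (_ , apart)    (suc j) = proj₂ (All.lookup⁺ apart j)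

pathAdj-sym : ∀ (i j : Fin k) → pathAdj i j ≡ pathAdj j i
pathAdj-sym i j = Bool.∨-comm (suc (toℕ i) ≡ᵇ toℕ j) (suc (toℕ j) ≡ᵇ toℕ i)

inducedPath-adj : ∀ (G : Graph n) (ps : Vec (Fin n) k) → InducedPath G ps →
                  ∀ i j → adj G (Vec.lookup ps i) (Vec.lookup ps j) ≡ pathAdj i j
inducedPath-adj G (x ∷ _)  _             zero    zero    = irrefl G x
inducedPath-adj G (_ ∷ ps) (linked , _)  zero    (suc j) = linked-adj G ps linked j
inducedPath-adj G (_ ∷ ps) (linked , _)  (suc i) zero    =
  trans (sym G _ _) (trans (linked-adj G ps linked i) (pathAdj-sym zero (suc i)))
inducedPath-adj G (_ ∷ ps) (_ , induced) (suc i) (suc j) = inducedPath-adj G ps induced i j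

inducedPath⇒minor : ∀ (G : Graph n) (ps : Vec (Fin n) t) → InducedPath G ps → HasPathVertexMinor t G
inducedPath⇒minor G ps induced =
  [] , Vec.lookup ps , inducedPath-injective G ps induced , inducedPath-adj G ps induced

-- Neighbourhoods and Gyárfás' path argument.

neighbours : Graph n → Fin n → Subset n
neighbours G x = tabulate (adj G x)

∈-neighbours⁺ : ∀ (G : Graph n) {x y} → adj G x y ≡ true → y ∈ neighbours G x
∈-neighbours⁺ G {x} {y} xy = lookup⇒[]= y _ (trans (lookup∘tabulate (adj G x) y) xy)

∈-neighbours⁻ : ∀ (G : Graph n) {x y} → y ∈ neighbours G x → adj G x y ≡ true
∈-neighbours⁻ G {x} {y} y∈ = trans (≡-sym (lookup∘tabulate (adj G x) y)) ([]=⇒lookup y∈)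

-- The hypothesis ranges over all `Z` because goodness does not pass to subsets (the clique must lie
-- in the set itself), while the argument meets neighbourhoods inside shrinking sets.
module Gyárfás (G : Graph n) (no-minor : ¬ HasPathVertexMinor t G) {s : ℕ} (X : Subset n)
  (neighbourhood-good : ∀ {x Z} → x ∈ X → Z ⊆ X → Good G s (Z ∩ neighbours G x)) where

  -- The neighbours of `v` in `C` cost `s`. Each component of the remainder is reached through one
  -- of them, which becomes the new end of the path; every extension lowers `j` by one, whence
  -- `j * s`.
  good-beyond : ∀ j {k} → k + j ≡ t → ∀ {v} {ps : Vec (Fin n) k} → InducedPath G (v ∷ ps) →
                ∀ {C} → C ⊆ X → Connected G C → v ∈ X → v ∉ C → Nonempty (C ∩ neighbours G v) →
                (∀ {x} → x ∈ C → All (NonEdge G x) ps) → Good G (j * s) C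
  -- Here `ps` alone, without `v`, already has `t` vertices.
  good-beyond zero {k} eq {ps = ps} (_ , induced) _ _ _ _ _ _ =
    ⊥-elim (no-minor (subst (λ t → HasPathVertexMinor t G) (trans (≡-sym (+-identityʳ k)) eq)
                            (inducedPath⇒minor G ps induced)))
  good-beyond (suc j) {k} eq {v} {ps} induced {C} C⊆X conn v∈X v∉C (d , d∈D) apart =
    good-+ G D⊆C (neighbourhood-good v∈X C⊆X) (good-components G (C ─ D) component-good)
    where
    D : Subset _
    D = C ∩ neighbours G v
    D⊆C : D ⊆ C
    D⊆C = p∩q⊆p C (neighbours G v)
    E⊆C : C ─ D ⊆ C
    E⊆C = p─q⊆p C D

    avoids-v : ∀ {x} → x ∈ C ─ D → NonEdge G x v
    avoids-v x∈ = (λ { refl → v∉C (E⊆C x∈) }) ,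
      Bool.¬-not (λ xv → x∈p─q⇒x∉q x∈ (x∈p∩q⁺ (E⊆C x∈ , ∈-neighbours⁺ G (trans (sym G _ _) xv))))

    component-good : ∀ K → Component G (C ─ D) K → Good G (j * s) K
    -- `d` lies in `C` outside `K`, so connectedness of `C` yields an edge leaving `K` within `C`.
    component-good K comp = extend
      (conn K (E⊆C ∘ K⊆X) nonempty
        (d , x∈p∧x∉q⇒x∈p─q (D⊆C d∈D) (λ d∈K → x∈p─q⇒x∉q (K⊆X d∈K) d∈D)))
      where
      open Component comp
      extend : Crossing G K (C ─ K) → Good G (j * s) K
      extend (y , w , y∈K , w∈C─K , yw) with w ∈? D
      -- Such an edge would stay in `C ─ D`, although `K` is a component there.
      ... | no  w∉D = contradiction
        (y , w , y∈K , x∈p∧x∉q⇒x∈p─q (x∈p∧x∉q⇒x∈p─q (p─q⊆p C K w∈C─K) w∉D) (x∈p─q⇒x∉q w∈C─K) , yw)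
        isolated
      -- `w` extends the path; `v` has no neighbour in `K`, since all its neighbours in `C` were
      -- removed with `D`.
      ... | yes w∈D = good-beyond j (trans (≡-sym (+-suc k j)) eq)
        ((Edge-sym G (adj⇒Edge G (∈-neighbours⁻ G (p∩q⊆q C _ w∈D))) , apart (D⊆C w∈D)) , induced)
        (C⊆X ∘ E⊆C ∘ K⊆X) connected (C⊆X (D⊆C w∈D)) (x∈p─q⇒x∉q w∈C─K)
        (y , x∈p∩q⁺ (y∈K , ∈-neighbours⁺ G (trans (sym G _ _) yw)))
        (λ x∈K → avoids-v (K⊆X x∈K) ∷ apart (E⊆C (K⊆X x∈K)))

  -- In each component one vertex is split off at cost 1 to start a path; by connectedness it has a
  -- neighbour in every component of what remains.
  good : Good G (1 + t * s) X
  good = good-components G X component-good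
    where
    component-good : ∀ K → Component G X K → Good G (1 + t * s) K
    component-good K comp with x , x∈K ← Component.nonempty comp =
      good-+ G x⊆K (good-singleton G) (good-components G (K ─ ⁅ x ⁆) rest-good)
      where
      open Component comp
      x⊆K : ⁅ x ⁆ ⊆ K
      x⊆K y∈ with refl ← x∈⁅y⁆⇒x≡y x y∈ = x∈K
      rest-good : ∀ L → Component G (K ─ ⁅ x ⁆) L → Good G (t * s) L
      rest-good L compL = attach (connected L (rest⊆K ∘ L.K⊆X) L.nonempty (x , x∈p∧x∉q⇒x∈p─q x∈K x∉L))
        where
        module L = Component compL
        rest⊆K : K ─ ⁅ x ⁆ ⊆ K
        rest⊆K = p─q⊆p K ⁅ x ⁆
        x∉L : x ∉ L
        x∉L x∈L = x∈p─q⇒x∉q (L.K⊆X x∈L) (x∈⁅x⁆ x)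
        attach : Crossing G L (K ─ L) → Good G (t * s) L
        attach (y , z , y∈L , z∈K─L , yz) with z ≟ x
        ... | no z≢x = contradiction
          (y , z , y∈L , x∈p∧x∉q⇒x∈p─q (x∈p∧x∉q⇒x∈p─q (p─q⊆p K L z∈K─L) (x≢y⇒x∉⁅y⁆ z≢x)) (x∈p─q⇒x∉q z∈K─L) , yz)
          L.isolated
        -- The path consists of `x` alone, so `k` is 0 and `j` is `t`.
        ... | yes refl = good-beyond t refl {v = x} {[]} (tt , tt) (K⊆X ∘ rest⊆K ∘ L.K⊆X) L.connected (K⊆X x∈K) x∉L
          (y , x∈p∩q⁺ (y∈L , ∈-neighbours⁺ G (trans (sym G _ _) yz))) (λ _ → [])

-- Local complementation

module _ (G : Graph n) (v : Fin n) where

  -- The formula is one `step` of `lcSeqAdj`, so prefixing `v` to a sequence of local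
  -- complementations is justified by computation alone.
  lcAdj : Fin n → Fin n → _
  lcAdj x y = if not (does (x ≟ y)) ∧ adj G v x ∧ adj G v y then not (adj G x y) else adj G x y

  lcAdj-fixʳ : ∀ {x y} → adj G v y ≡ false → lcAdj x y ≡ adj G x y
  lcAdj-fixʳ {x} {y} vy rewrite vy | Bool.∧-zeroʳ (adj G v x) | Bool.∧-zeroʳ (not (does (x ≟ y))) = refl

  lcAdj-sym : ∀ x y → lcAdj x y ≡ lcAdj y x
  lcAdj-sym x y with x ≟ y | y ≟ x
  ... | yes _    | yes _   = sym G x y
  ... | yes refl | no  x≢x = contradiction refl x≢x
  ... | no  x≢x  | yes refl = contradiction refl x≢x
  ... | no  _    | no  _   rewrite sym G x y | Bool.∧-comm (adj G v x) (adj G v y) = refl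

  lcAdj-fixˡ : ∀ {x y} → adj G v x ≡ false → lcAdj x y ≡ adj G x y
  lcAdj-fixˡ {x} {y} vx = trans (lcAdj-sym x y) (trans (lcAdj-fixʳ vx) (sym G y x))

  lcAdj-flip : ∀ {x y} → x ≢ y → adj G v x ≡ true → adj G v y ≡ true → lcAdj x y ≡ not (adj G x y)
  lcAdj-flip {x} {y} x≢y vx vy rewrite dec-false (x ≟ y) x≢y | vx | vy = refl

  lcAdj-irrefl : ∀ x → lcAdj x x ≡ false
  lcAdj-irrefl x rewrite dec-true (x ≟ x) refl = irrefl G x

  localComplement : Graph n
  localComplement = record { adj = lcAdj ; sym = lcAdj-sym ; irrefl = lcAdj-irrefl }

  minor-localComplement : HasPathVertexMinor t localComplement → HasPathVertexMinor t G
  minor-localComplement (vs , path) = v ∷ vs , path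

  private
    G∗v = localComplement

  nonEdge-fixʳ : ∀ {x y} → adj G v y ≡ false → NonEdge G x y → NonEdge G∗v x y
  nonEdge-fixʳ vy (x≢y , xy) = x≢y , trans (lcAdj-fixʳ vy) xy

  linked-fixˡ : ∀ {x} (ps : Vec (Fin n) k) → adj G v x ≡ false → Linked G x ps → Linked G∗v x ps
  linked-fixˡ []       vx _                    = tt
  linked-fixˡ (_ ∷ ps) vx ((x≢p , xp) , apart) =
    (x≢p , trans (lcAdj-fixˡ vx) xp) , All.map (λ (x≢q , xq) → x≢q , trans (lcAdj-fixˡ vx) xq) apart

  linked-fixʳ : ∀ {x} (ps : Vec (Fin n) k) → All (NonEdge G v) ps → Linked G x ps → Linked G∗v x ps
  linked-fixʳ []       _          _                    = tt
  linked-fixʳ (_ ∷ ps) (vp ∷ vps) ((x≢p , xp) , apart) =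
    (x≢p , trans (lcAdj-fixʳ (proj₂ vp)) xp) ,
    All.map (λ (vq , xq) → nonEdge-fixʳ (proj₂ vq) xq) (All.zip (vps , apart))

  inducedPath-fix : ∀ (ps : Vec (Fin n) k) → All (NonEdge G v) ps → InducedPath G ps → InducedPath G∗v ps
  inducedPath-fix []       _          _                  = tt
  inducedPath-fix (_ ∷ ps) (_ ∷ vps) (linked , induced) = linked-fixʳ ps vps linked , inducedPath-fix ps vps induced

  -- Local complementation at `v` changes only pairs of neighbours of `v`, and `v` has at most one
  -- neighbour on `ps`, its head.
  inducedPath-extend : ∀ (ps : Vec (Fin n) k) → Linked G v ps → InducedPath G ps → InducedPath G∗v (v ∷ ps)
  inducedPath-extend []       _                   _                  = tt , tt
  inducedPath-extend (_ ∷ ps) linked@(_ , apart) (linked′ , induced) =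
    linked-fixˡ _ (irrefl G v) linked , linked-fixʳ ps apart linked′ , inducedPath-fix ps apart induced

  -- Both `x` and the head of `ps` are neighbours of `v`, so the edge between them disappears; the
  -- other path vertices are not adjacent to `v` and keep their nonedges to `x`.
  linked-extend : ∀ {x} (ps : Vec (Fin n) k) → Linked G v ps → adj G v x ≡ true → Linked G x ps →
                  Linked G∗v x (v ∷ ps)
  linked-extend {x = x} ps linked vx linked′ =
    Edge-sym G∗v (proj₁ vx′ , trans (lcAdj-fixˡ (irrefl G v)) vx) , apart ps linked linked′
    where
    vx′ : Edge G v x
    vx′ = adj⇒Edge G vx
    apart : ∀ {k} (ps : Vec (Fin n) k) → Linked G v ps → Linked G x ps → All (NonEdge G∗v x) ps
    apart []       _                  _                    = []
    apart (_ ∷ ps) ((_ , vp) , v-apart) ((x≢p , xp) , x-apart) =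
      (x≢p , trans (lcAdj-flip x≢p vx vp) (cong not xp)) ∷
      All.map (λ (vq , xq) → nonEdge-fixʳ (proj₂ vq) xq) (All.zip (v-apart , x-apart))

  -- Inside `neighbours G v` local complementation is plain complementation, so the two halves of
  -- `Good` trade places.
  good-localComplement : ∀ {D} → D ⊆ neighbours G v → Good G∗v g D → Good G g D
  good-localComplement {D = D} D⊆N (P , P′) =
    balanced-map nonEdge⇒edge′ edge⇒nonEdge P′ , balanced-map edge⇒nonEdge′ nonEdge⇒edge P
    where
    flip : ∀ {x y} → x ∈ D → y ∈ D → x ≢ y → lcAdj x y ≡ not (adj G x y)
    flip x∈D y∈D x≢y = lcAdj-flip x≢y (∈-neighbours⁻ G (D⊆N x∈D)) (∈-neighbours⁻ G (D⊆N y∈D))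
    edge⇒nonEdge : ∀ {x y} → x ∈ D → y ∈ D → Edge G x y → NonEdge G∗v x y
    edge⇒nonEdge x∈D y∈D (x≢y , xy) = x≢y , trans (flip x∈D y∈D x≢y) (cong not xy)
    nonEdge⇒edge : ∀ {x y} → x ∈ D → y ∈ D → NonEdge G x y → Edge G∗v x y
    nonEdge⇒edge x∈D y∈D (x≢y , xy) = x≢y , trans (flip x∈D y∈D x≢y) (cong not xy)
    edge⇒nonEdge′ : ∀ {x y} → x ∈ D → y ∈ D → Edge G∗v x y → NonEdge G x y
    edge⇒nonEdge′ x∈D y∈D (x≢y , xy) = x≢y , Bool.not-injective (trans (≡-sym (flip x∈D y∈D x≢y)) xy)
    nonEdge⇒edge′ : ∀ {x y} → x ∈ D → y ∈ D → NonEdge G∗v x y → Edge G x y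
    nonEdge⇒edge′ x∈D y∈D (x≢y , xy) = x≢y , Bool.not-injective (trans (≡-sym (flip x∈D y∈D x≢y)) xy)

-- Induction on the number of missing path vertices.

goodness : ℕ → ℕ → ℕ
-- At zero the path is complete and the excluded minor appears; the successor case is the bound
-- `1 + t * s` of the path argument.
goodness t zero    = 0
goodness t (suc r) = 1 + t * goodness t r

-- `G` varies along the recursion: the neighbourhood of `x` is treated in `localComplement G x`,
-- with `x` added to the path, and the result is carried back to `G`.
good-linked : ∀ r {k} → k + r ≡ t → ∀ (G : Graph n) → ¬ HasPathVertexMinor t G →
              ∀ (ps : Vec (Fin n) k) → InducedPath G ps →
              ∀ X → (∀ {x} → x ∈ X → Linked G x ps) → Good G (goodness t r) X
good-linked zero {k} eq G no-minor ps induced X linked =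
  ⊥-elim (no-minor (subst (λ t → HasPathVertexMinor t G) (trans (≡-sym (+-identityʳ k)) eq)
                          (inducedPath⇒minor G ps induced)))
good-linked (suc r) {k} eq G no-minor ps induced X linked = Gyárfás.good G no-minor X λ {x} {Z} x∈X Z⊆X →
  good-localComplement G x (p∩q⊆q Z (neighbours G x))
    (good-linked r (trans (≡-sym (+-suc k r)) eq) (localComplement G x) (no-minor ∘ minor-localComplement G x)
      (x ∷ ps) (inducedPath-extend G x ps (linked x∈X) induced) (Z ∩ neighbours G x)
      λ y∈ → linked-extend G x ps (linked x∈X) (∈-neighbours⁻ G (p∩q⊆q Z _ y∈))
                                  (linked (Z⊆X (p∩q⊆p Z _ y∈))))

-- From goodness of the whole vertex set to a colouring.

HasClique-AllPairs : ∀ (G : Graph n) {ws} → AllPairs (Edge G) ws → HasClique G (length ws)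
HasClique-AllPairs G {ws} pairwise = lookup ws , injective , λ i j i≢j → proj₂ (edge i≢j)
  where
  edge : ∀ {i j} → i ≢ j → Edge G (lookup ws i) (lookup ws j)
  edge = AllPairs-lookup (Edge-sym G) pairwise
  injective : ∀ {i j} → lookup ws i ≡ lookup ws j → i ≡ j
  injective {i} {j} eq with i ≟ j
  ... | yes i≡j = i≡j
  ... | no  i≢j = contradiction eq (proj₁ (edge i≢j))

good⇒colourable : ∀ (G : Graph n) → Good G g ⊤ → ∀ w → CliqueNumber G w → Colourable G (g * w)
good⇒colourable {g = g} G (P , _) w (_ , no-larger) =
  (λ x → fromℕ< (below x)) ,
  λ x y xy eq → proper ∈⊤ ∈⊤ (adj⇒Edge G xy) (fromℕ<-injective _ _ (below x) (below y) eq)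
  where
  open Balanced P
  clique≤w : length clique ≤ w
  clique≤w with ≤-<-connex (length clique) w
  ... | inj₁ ≤w = ≤w
  -- The first `suc w` entries of a longer clique would form one that `no-larger` forbids.
  ... | inj₂ w< = ⊥-elim (no-larger (subst (HasClique G) (length-take-≤ (suc w) clique w<)
                                      (HasClique-AllPairs G (AllPairs.take⁺ (suc w) pairwise))))
  below : ∀ x → colour x < g * w
  below x = <-≤-trans (bounded ∈⊤) (*-monoʳ-≤ g clique≤w)

theorem5p3 : (t : ℕ) → 1 ≤ t →
    Σ ℕ λ a → Σ ℕ λ b →
    ∀ (n : ℕ) (H : Graph n) → ¬ HasPathVertexMinor t H →
    ∀ (w : ℕ) → CliqueNumber H w → Colourable H (a * w + b)
theorem5p3 t _ = goodness t t , 0 , λ n H no-minor w ω≡w →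
  subst (Colourable H) (≡-sym (+-identityʳ _))
    -- The induction starts at the empty path, with all `t` vertices missing and every vertex
    -- trivially linked.
    (good⇒colourable H (good-linked t refl H no-minor [] tt ⊤ λ _ → tt) w ω≡w)
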